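{- Let $P \subseteq \Sigma_1 \times \cdots \times \Sigma_m$ be a non-degenerate predicate, where $|\Sigma_i| \geq 2$ for all $i$. Let $\Phi$ be such that for all $(\phi_1,\dots,\phi_m) \in \Phi$ and for all $i$, the function $\phi_i$ is a permutation of $\Sigma_i$. If $P$ is $\Phi$-trivial for $n = 1$ then it is also $\Phi$-trivial for $n = 2$, unless one of the following cases holds: \begin{enumerate} \item There is a coordinate $i \in [m]$ and $\sigma \in \Sigma_i$ such that $P$ is closed under setting $i$ to $\sigma$, meaning that whenever $y \in P$ then also $y|_{i \gets \sigma} \in P$, where $y|_{i \gets \sigma}$ is obtained from $y$ by changing $y_i$ to $\sigma$. \item $P$ has a non-dictatorial AND/OR polymorphism. An AND/OR polymorphism is a polymorphism $f_1,\dots,f_m$ where $f_i\colon \Sigma_i^2 \to \Sigma_i$ is as follows. If $|\Sigma_i| > 2$ then $f_i(x) = x_1$. If $|\Sigma_i| = 2$, without loss of generality $\Sigma_i = \{0, 1\}$, then either $f_i(x) = x_1 \land x_2$ or $f_i(x) = x_1 \lor x_2$. \item $P$ has a Latin square polymorphism conforming to $\Phi$. A Latin square polymorphism is a polymorphism $f_1,\dots,f_m$ where each $f_i\colon \Sigma_i^2 \to \Sigma_i$ is a Latin square: viewed as a $\Sigma_i \times \Sigma_i$ matrix, each row and each column is a permutation of $\Sigma_i$. The functions conform to $\Phi$ if for all $y \in P$ we have $(f_1(y_1,\cdot),\dots,f_m(y_m,\cdot)), (f_1(\cdot,y_1),\dots,f_m(\cdot,y_m)) \in \Phi$, where $f_i(y_i,\cdot)$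 is the function $\sigma \mapsto f_i(y_i,\sigma)$. \end{enumerate} Furthermore, if $\Sigma_1 = \cdots = \Sigma_m = \{0, 1\}$ and $P$ is not $\Phi$-trivial for $n = 1$ then this is witnessed either by a polymorphism $f_1,\dots,f_m\colon \{0,1\} \to \{0,1\}$ where $f_i(x) \in \{0, 1, x\}$ for all $i$, or by a polymorphism $f_1,\dots,f_m\colon \{0,1\} \to \{0,1\}$ where $f_i(x) \in \{x, \bar{x}\}$ for all $i$.
   Context: $P \subseteq \Sigma_1 \times \cdots \times \Sigma_m$ with finite $\Sigma_i$. $P$ is non-degenerate if (i) for each $i \in [m]$ and $\sigma \in \Sigma_i$ some $y \in P$ has $y_i = \sigma$, and (ii) for each $i$ there are $y \in P$, $z \notin P$ differing only in coordinate $i$. Functions $f_i\colon \Sigma_i^n \to \Sigma_i$ form an $n$-ary polymorphism of $P$ if whenever $x^{(i)} \in \Sigma_i^n$ satisfy $(x^{(1)}_j,\dots,x^{(m)}_j) \in P$ for all $j \in [n]$, then $(f_1(x^{(1)}),\dots,f_m(x^{(m)})) \in P$. For a collection $\Phi$ of tuples $(\phi_1,\dots,\phi_m)$, $\phi_i\colon\Sigma_i\to\Sigma_i$, $P$ is $\Phi$-trivial for $n = n_0$ if every $n_0$-ary polymorphism is either of dictatorial type (there are $j \in [n_0]$ and $(\phi_1,\dots,\phi_m) \in \Phi$ with $f_i(x) = \phi_i(x_j)$ for all $i$) or of certificate type (there is a partial assignment $\rho$ with domain $S \subseteq [m]$, $\rho_i \in \Sigma_i$, such that every $y$ agreeing with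 $\rho$ on $S$ lies in $P$, and $f_i$ is the constant $\rho_i$ function for each $i \in S$). A polymorphism is called dictatorial if it is of dictatorial type; $\bar{x} = 1-x$. -}

module Defs where

open import Data.Nat using (ℕ; _≤_; _<_; _⊓_; _⊔_; _∸_)
open import Data.Fin using (Fin; toℕ; _≟_)
open import Data.Vec using (Vec; lookup; _∷_; []; head)
open import Data.Bool using (Bool)
open import Data.Maybe using (Maybe; just)
open import Data.Product using (Σ; ∃; _×_; _,_)
open import Data.Sum using (_⊎_)
open import Relation.Nullary using (¬_; Dec; yes; no)
open import Relation.Binary.PropositionalEquality using (_≡_; _≢_; refl)
open import Function.Definitions using (Bijective)

Tuple : (m : ℕ) → (Fin m → ℕ) → Set
Tuple m k = (i : Fin m) → Fin (k i)

FunTuple : (m : ℕ) → (Fin m → ℕ) → Set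
FunTuple m k = (i : Fin m) → Fin (k i) → Fin (k i)

update : ∀ {m} {k : Fin m → ℕ} → Tuple m k → (i : Fin m) → Fin (k i) → Tuple m k
update y i σ j with i ≟ j
... | yes refl = σ
... | no _ = y j

-- A subset of a finite set (decidable, and invariant under pointwise equality
-- of its elements, as any set of functions is in set theory).
record FinPred (A : Set) (_≈_ : A → A → Set) : Set₁ where
  field
    _∈P : A → Set
    dec : ∀ a → Dec (a ∈P)
    ext : ∀ a b → a ≈ b → a ∈P → b ∈P

_≈T_ : ∀ {m k} → Tuple m k → Tuple m k → Set
y ≈T z = ∀ i → y i ≡ z i

_≈F_ : ∀ {m k} → FunTuple m k → FunTuple m k → Set
φ ≈F ψ = ∀ i σ → φ i σ ≡ ψ i σ

Predicate : (m : ℕ) → (Fin m → ℕ) → Set₁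
Predicate m k = FinPred (Tuple m k) _≈T_

Collection : (m : ℕ) → (Fin m → ℕ) → Set₁
Collection m k = FinPred (FunTuple m k) _≈F_

module _ {m : ℕ} {k : Fin m → ℕ} (P : Predicate m k) where
  open FinPred P renaming (_∈P to inP)

  NonDegenerate : Set
  NonDegenerate =
    (∀ i (σ : Fin (k i)) → Σ (Tuple m k) λ y → inP y × y i ≡ σ)
    × (∀ i → Σ (Tuple m k) λ y → Σ (Tuple m k) λ z →
         inP y × ¬ inP z × (∀ j → j ≢ i → y j ≡ z j))

  NFun : ℕ → Set
  NFun n = (i : Fin m) → Vec (Fin (k i)) n → Fin (k i)

  IsPolymorphism : (n : ℕ) → NFun n → Set
  IsPolymorphism n f = (X : (i : Fin m) → Vec (Fin (k i)) n) →
    (∀ j → inP (λ i → lookup (X i) j)) → inP (λ i → f i (X i))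

  module _ (Φ : Collection m k) where
    open FinPred Φ renaming (_∈P to inΦ)

    DictatorialType : (n : ℕ) → NFun n → Set
    DictatorialType n f = Σ (Fin n) λ j → Σ (FunTuple m k) λ φ →
      inΦ φ × (∀ i x → f i x ≡ φ i (lookup x j))

    -- partial assignment ρ : domain S = { i | ρ i ≡ just _ }
    CertificateType : (n : ℕ) → NFun n → Set
    CertificateType n f = Σ ((i : Fin m) → Maybe (Fin (k i))) λ ρ →
      (∀ (y : Tuple m k) → (∀ i σ → ρ i ≡ just σ → y i ≡ σ) → inP y)
      × (∀ i σ → ρ i ≡ just σ → ∀ x → f i x ≡ σ)

    Trivial : ℕ → Set
    Trivial n = ∀ f → IsPolymorphism n f → DictatorialType n f ⊎ CertificateType n f

    ClosedUnderSetting : Set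
    ClosedUnderSetting = Σ (Fin m) λ i → Σ (Fin (k i)) λ σ →
      ∀ y → inP y → inP (update y i σ)

    -- Case 2 (on Σ_i = {0,1} = Fin 2, AND = min and OR = max on 0/1 values)
    AndOrComponent : (i : Fin m) → (Vec (Fin (k i)) 2 → Fin (k i)) → Set
    AndOrComponent i g =
      (2 < k i × (∀ x → g x ≡ head x))
      ⊎ (k i ≡ 2 × ((∀ a b → toℕ (g (a ∷ b ∷ [])) ≡ toℕ a ⊓ toℕ b)
                   ⊎ (∀ a b → toℕ (g (a ∷ b ∷ [])) ≡ toℕ a ⊔ toℕ b)))

    HasNonDictatorialAndOr : Set
    HasNonDictatorialAndOr = Σ (NFun 2) λ f →
      IsPolymorphism 2 f × (∀ i → AndOrComponent i (f i)) × ¬ DictatorialType 2 f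

    IsLatinSquare : (i : Fin m) → (Vec (Fin (k i)) 2 → Fin (k i)) → Set
    IsLatinSquare i g =
      (∀ a → Bijective _≡_ _≡_ (λ σ → g (a ∷ σ ∷ [])))
      × (∀ a → Bijective _≡_ _≡_ (λ σ → g (σ ∷ a ∷ [])))

    HasConformingLatinSquare : Set
    HasConformingLatinSquare = Σ (NFun 2) λ f →
      IsPolymorphism 2 f × (∀ i → IsLatinSquare i (f i))
      × (∀ y → inP y → inΦ (λ i σ → f i (y i ∷ σ ∷ []))
                      × inΦ (λ i σ → f i (σ ∷ y i ∷ [])))

    Witnesses1 : NFun 1 → Set
    Witnesses1 f = IsPolymorphism 1 f × ¬ (DictatorialType 1 f ⊎ CertificateType 1 f)

    ConstOrId : NFun 1 → Set
    ConstOrId f = ∀ i → (∀ x → toℕ (f i (x ∷ [])) ≡ 0)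
                      ⊎ (∀ x → toℕ (f i (x ∷ [])) ≡ 1)
                      ⊎ (∀ x → f i (x ∷ []) ≡ x)

    IdOrNeg : NFun 1 → Set
    IdOrNeg f = ∀ i → (∀ x → f i (x ∷ []) ≡ x)
                    ⊎ (∀ x → toℕ (f i (x ∷ [])) ≡ 1 ∸ toℕ x)

{-# OPTIONS --safe #-}
module Submission where

-- By triviality for n = 1, every row f(x, ·) with x ∈ P of a binary polymorphism
-- f either lies in Φ or is "certified": its constant coordinates form a
-- certificate. Assume P is not closed under setting a coordinate. Then P is
-- rigid: if a bijective unary polymorphism h stays a polymorphism under
-- arbitrary changes of its values outside a set Q of pairs (i, σ), then Q
-- contains all pairs, since otherwise h⁻¹ composed with a non-injective change
-- at one pair fixes all coordinates but one.
--
-- * All rows certified: the constants of the rows, extended to a map h on each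
--   Σ_i, give a unary polymorphism. If h ∈ Φ then by rigidity all rows are
--   constant and f is the dictator h(x₁); otherwise f is of certificate type.
-- * Mixed rows: iterating the rows turns those in Φ into identities. By rigidity
--   not all columns are certified, and for a column z in Φ every row of f is the
--   identity or constant. Composing with the inverse of column z yields the
--   polymorphism "if x₁ = z_i then x₂ else x₁", which is AND or OR on binary
--   coordinates; on the other coordinates it may be replaced by x₁.
-- * All rows and (by symmetry) all columns in Φ: f is a conforming Latin square.
--
-- In the Boolean case a polymorphism with a constant coordinate is squared, which
-- turns negations into identities.

open import Defs
open import Data.Nat using (ℕ; zero; suc; _*_; _≤_; _⊔_; _⊓_; _∸_; _!; s≤s)
import Data.Nat as ℕ
import Data.Nat.Properties as ℕₚ
open import Data.Nat.Divisibility using (divides; ∣-trans; m∣m*n; m≤n⇒m!∣n!)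
open import Data.Nat.GeneralisedArithmetic using (fold; fold-+)
open import Data.Fin using (Fin; zero; suc; toℕ; _≟_)
open import Data.Fin.Properties using (all?; any?; ¬∀⟶∃¬; ∀-cons; pigeonhole; toℕ<n; toℕ-injective)
open import Data.Vec using (Vec; []; _∷_; [_]; lookup; head; replicate)
open import Data.Vec.Functional using (updateAt)
open import Data.Vec.Functional.Properties using (updateAt-updates; updateAt-minimal)
open import Data.Maybe using (Maybe; just; nothing)
open import Data.Maybe.Properties using (just-injective)
open import Data.Empty using (⊥; ⊥-elim)
open import Data.Product using (Σ; ∃; _×_; _,_; proj₁; proj₂)
open import Data.Sum using (_⊎_; inj₁; inj₂)
import Data.Sum as Sum
open import Function using (_∘_; id; const; flip)
open import Relation.Nullary using (¬_; Dec; yes; no; ¬?; contradiction)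
open import Relation.Nullary.Decidable using (map′; _→-dec_; _⊎-dec_)
open import Relation.Unary using (Decidable)
open import Relation.Binary.PropositionalEquality using (_≡_; _≢_; refl; sym; trans; cong; cong₂; subst)
open import Function.Definitions using (Injective; Bijective)

Inj : {A : Set} → (A → A) → Set
Inj = Injective _≡_ _≡_

Const : {A B : Set} → (A → B) → Set
Const g = ∀ u v → g u ≡ g v

-- Searching finite types

-- A form of omniscience that needs no decision of S: B is typically the
-- existence of a counterexample, or a conclusion that makes the search moot.
Compact : (A : Set) (_≈_ : A → A → Set) → Set₁
Compact A _≈_ = (S : A → Set) (B : Set) → (∀ a b → a ≈ b → S a → S b) →
  (∀ a → S a ⊎ B) → (∀ a → S a) ⊎ B

compact-Fin : ∀ n → Compact (Fin n) _≡_
compact-Fin zero    S B resp s = inj₁ λ ()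
compact-Fin (suc n) S B resp s with s zero | compact-Fin n (S ∘ suc) B (λ { _ _ refl → id }) (s ∘ suc)
... | inj₂ b  | _       = inj₂ b
... | inj₁ _  | inj₂ b  = inj₂ b
... | inj₁ s₀ | inj₁ s₊ = inj₁ (∀-cons s₀ s₊)

-- Fixing the value at `zero` leaves a search over the tails. `resp` identifies a function with the
-- one rebuilt from its head and tail.
compact-Π : ∀ n (A : Fin n → Set) (_≈_ : ∀ {i} → A i → A i → Set) → (∀ {i} {a : A i} → a ≈ a) →
  (∀ i → Compact (A i) _≈_) → Compact (∀ i → A i) (λ f g → ∀ i → f i ≈ g i)
compact-Π zero A _≈_ rfl c S B resp s = Sum.map₁ (λ s₀ g → resp (λ ()) g (λ ()) s₀) (s λ ())
compact-Π (suc n) A _≈_ rfl c S B resp s =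
  Sum.map₁ (λ all g → resp _ _ (∀-cons rfl λ _ → rfl) (all (g zero) (g ∘ suc)))
    (c zero (λ a → ∀ g → S (∀-cons a g)) B
       (λ a b a≈b t g → resp _ _ (∀-cons a≈b λ _ → rfl) (t g))
       λ a → compact-Π n (A ∘ suc) _≈_ rfl (c ∘ suc) (λ g → S (∀-cons a g)) B
               (λ g h g≈h → resp _ _ (∀-cons rfl g≈h)) (λ g → s (∀-cons a g)))

compact-Tuple : ∀ {m} (k : Fin m → ℕ) → Compact (Tuple m k) _≈T_
compact-Tuple k = compact-Π _ _ _≡_ refl λ i → compact-Fin (k i)

compact-FunTuple : ∀ {m} (k : Fin m → ℕ) → Compact (FunTuple m k) _≈F_
compact-FunTuple k =
  compact-Π _ _ (λ f g → ∀ a → f a ≡ g a) (λ _ → refl) λ i →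
    compact-Π _ _ _≡_ refl λ _ → compact-Fin (k i)

BinTuple : (m : ℕ) → (Fin m → ℕ) → Set
BinTuple m k = (i : Fin m) → Fin (k i) → Fin (k i) → Fin (k i)

_≈B_ : ∀ {m k} → BinTuple m k → BinTuple m k → Set
f ≈B g = ∀ i a b → f i a b ≡ g i a b

compact-BinTuple : ∀ {m} (k : Fin m → ℕ) → Compact (BinTuple m k) _≈B_
compact-BinTuple k =
  compact-Π _ _ (λ f g → ∀ a b → f a b ≡ g a b) (λ _ _ → refl) λ i →
    compact-Π _ _ (λ f g → ∀ b → f b ≡ g b) (λ _ → refl) λ _ →
      compact-Π _ _ _≡_ refl λ _ → compact-Fin (k i)

all-Vec? : ∀ {n l} {Q : Vec (Fin n) l → Set} → Decidable Q → Dec (∀ v → Q v)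
all-Vec? {l = zero}  Q? = map′ (λ { q [] → q }) (λ q → q []) (Q? [])
all-Vec? {l = suc l} Q? =
  map′ (λ { q (a ∷ v) → q a v }) (λ q a v → q (a ∷ v)) (all? λ a → all-Vec? λ v → Q? (a ∷ v))

const? : ∀ {n n′} (g : Fin n → Fin n′) → Dec (Const g)
const? g = all? λ u → all? λ v → g u ≟ g v

const-Vec? : ∀ {n n′ l} (g : Vec (Fin n) l → Fin n′) → Dec (Const g)
const-Vec? g = all-Vec? λ u → all-Vec? λ v → g u ≟ g v

-- Self-maps of Fin n

first : ∀ {n} → 2 ≤ n → Fin n
first (s≤s _) = zero

other : ∀ {n} → 2 ≤ n → Fin n → Fin n
other (s≤s (s≤s _)) zero    = suc zero
other (s≤s (s≤s _)) (suc _) = zero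

other-≢ : ∀ {n} (2≤n : 2 ≤ n) a → other 2≤n a ≢ a
other-≢ (s≤s (s≤s _)) zero    ()
other-≢ (s≤s (s≤s _)) (suc _) ()

inj⇒¬const : ∀ {n} → 2 ≤ n → {g : Fin n → Fin n} → Inj g → Fin n → ¬ Const g
inj⇒¬const 2≤n inj a c = other-≢ 2≤n a (inj (c _ _))

fold-injective : ∀ {A : Set} {h : A → A} → Inj h → ∀ n {a b} → fold a h n ≡ fold b h n → a ≡ b
fold-injective inj zero    eq = eq
fold-injective inj (suc n) eq = fold-injective inj n (inj eq)

fold-period : ∀ {A : Set} (h : A → A) {a} p → fold a h p ≡ a → ∀ q → fold a h (q * p) ≡ a
fold-period h p eq zero = refl
fold-period h {a} p eq (suc q) =
  trans (fold-+ a h p) (trans (cong (λ b → fold b h p) (fold-period h p eq q)) eq)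

-- Two of the `n + 1` iterates of `h` on `a` with exponents 0 to `n` coincide; injectivity cancels
-- the smaller exponent.
orbit-period : ∀ {n} {h : Fin n → Fin n} → Inj h → ∀ a → ∃ λ p → suc p ≤ n × fold a h (suc p) ≡ a
orbit-period {n} {h} inj a with pigeonhole {n} ℕₚ.≤-refl (λ j → fold a h (toℕ j))
... | i , j , i<j , eq with ℕₚ.m≤n⇒∃[o]m+o≡n i<j
... | p , i+p≡j = p ,
  ℕₚ.≤-trans (ℕₚ.≤-trans (s≤s (ℕₚ.m≤n+m p (toℕ i))) (ℕₚ.≤-reflexive i+p≡j)) (ℕₚ.≤-pred (toℕ<n j)) ,
  sym (fold-injective inj (toℕ i)
    (trans eq (trans (cong (fold a h) (trans (sym i+p≡j) (sym (ℕₚ.+-suc (toℕ i) p)))) (fold-+ a h (toℕ i)))))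

!-period : ∀ {n K} → n ≤ K → {h : Fin n → Fin n} → Inj h → ∀ a → fold a h (K !) ≡ a
!-period {n} {K} n≤K {h} inj a with orbit-period inj a
... | p , p<n , eq with ∣-trans (m∣m*n (p !)) (m≤n⇒m!∣n! (ℕₚ.≤-trans p<n n≤K))
... | divides q K!≡ = trans (cong (fold a h) K!≡) (fold-period h (suc p) eq q)

bounded : ∀ {m} (k : Fin m → ℕ) → ∃ λ K → ∀ i → k i ≤ K
bounded {zero}  k = 0 , λ ()
bounded {suc m} k with bounded (k ∘ suc)
... | K , k≤K = k zero ⊔ K ,
  ∀-cons (ℕₚ.m≤m⊔n _ _) λ i → ℕₚ.≤-trans (k≤K i) (ℕₚ.m≤n⊔m (k zero) K)

-- Every orbit length divides the factorial of a common bound on the `k i`. With the period written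
-- as `suc N`, the `N`-th iterate is an inverse.
common-period : ∀ {m} (k : Fin m → ℕ) →
  ∃ λ N → ∀ i {h : Fin (k i) → Fin (k i)} → Inj h → ∀ a → fold a h (suc N) ≡ a
common-period k with bounded k
... | K , k≤K with K ! in eq | ℕₚ.1≤n! K
... | suc N | _ = N , λ i inj a → trans (cong (fold a _) (sym eq)) (!-period (k≤K i) inj a)

-- If `R` fails at `σ`, the value there is free: choosing it different from the value at another
-- point `τ` keeps `g` from being constant.
spread : ∀ {n} → 2 ≤ n → (c : Fin n → Fin n) {R : Fin n → Set} → Decidable R →
  ∃ λ g → (∀ a → R a → g a ≡ c a) × (Const g → ∀ a → R a)
spread {n} 2≤n c {R} R? with all? R?
... | yes r = c , (λ _ _ → refl) , λ _ → r
... | no ¬r with ¬∀⟶∃¬ n R R? ¬r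
... | σ , ¬rσ = updateAt c σ (const v) ,
  (λ a ra → updateAt-minimal a σ c λ { refl → ¬rσ ra }) ,
  λ cst → ⊥-elim (other-≢ 2≤n (c τ)
    (trans (sym (updateAt-updates σ c)) (trans (cst σ τ) (updateAt-minimal τ σ c (other-≢ 2≤n σ)))))
  where
  τ = other 2≤n σ
  v = other 2≤n (c τ)

-- sel d a b is AND (d = 1) or OR (d = 0) on {0,1}.
sel : ∀ {n} → Fin n → Fin n → Fin n → Fin n
sel d a b with a ≟ d
... | yes _ = b
... | no  _ = a

sel-≡ : ∀ {n} {d a : Fin n} b → a ≡ d → sel d a b ≡ b
sel-≡ {d = d} {a} b a≡d with a ≟ d
... | yes _  = refl
... | no a≢d = contradiction a≡d a≢d

sel-≢ : ∀ {n} {d a : Fin n} b → a ≢ d → sel d a b ≡ a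
sel-≢ {d = d} {a} b a≢d with a ≟ d
... | yes a≡d = contradiction a≡d a≢d
... | no _    = refl

sel-idem : ∀ {n} (d a : Fin n) → sel d a a ≡ a
sel-idem d a with a ≟ d
... | yes _ = refl
... | no  _ = refl

sel-AND/OR : ∀ {n} → n ≡ 2 → (d : Fin n) →
  (∀ a b → toℕ (sel d a b) ≡ toℕ a ⊓ toℕ b) ⊎ (∀ a b → toℕ (sel d a b) ≡ toℕ a ⊔ toℕ b)
sel-AND/OR refl zero = inj₂ λ where
  zero       zero       → refl
  zero       (suc zero) → refl
  (suc zero) zero       → refl
  (suc zero) (suc zero) → refl
sel-AND/OR refl (suc zero) = inj₁ λ where
  zero       zero       → refl
  zero       (suc zero) → refl
  (suc zero) zero       → refl
  (suc zero) (suc zero) → refl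

two-elements : ∀ {n} → 2 ≤ n → (d e : Fin n) → (∀ a → a ≡ d ⊎ a ≡ e) → n ≡ 2
two-elements {suc (suc zero)}    _ d e c = refl
two-elements {suc (suc (suc n))} _ d e c with c zero | c (suc zero) | c (suc (suc zero))
... | inj₁ refl | inj₂ refl | inj₁ ()
... | inj₁ refl | inj₂ refl | inj₂ ()
... | inj₂ refl | inj₁ refl | inj₁ ()
... | inj₂ refl | inj₁ refl | inj₂ ()
two-elements {suc zero} (s≤s ()) d e c

boolean-const : ∀ {n} → n ≡ 2 → (g : Fin n → Fin n) → Const g →
  (∀ x → toℕ (g x) ≡ 0) ⊎ (∀ x → toℕ (g x) ≡ 1)
boolean-const refl g cst with g zero in e₀
... | zero     = inj₁ λ x → cong toℕ (trans (cst x zero) e₀)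
... | suc zero = inj₂ λ x → cong toℕ (trans (cst x zero) e₀)

boolean-nonconst : ∀ {n} → n ≡ 2 → (g : Fin n → Fin n) → ¬ Const g →
  (∀ x → g x ≡ x) ⊎ (∀ x → toℕ (g x) ≡ 1 ∸ toℕ x)
boolean-nonconst refl g ¬cst with g zero in e₀ | g (suc zero) in e₁
... | zero     | suc zero = inj₁ λ { zero → e₀ ; (suc zero) → e₁ }
... | suc zero | zero     = inj₂ λ { zero → cong toℕ e₀ ; (suc zero) → cong toℕ e₁ }
... | zero     | zero     = contradiction (λ u v → trans (val u) (sym (val v))) ¬cst
  where
  val : ∀ x → g x ≡ zero
  val = λ { zero → e₀ ; (suc zero) → e₁ }
... | suc zero | suc zero = contradiction (λ u v → trans (val u) (sym (val v))) ¬cst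
  where
  val : ∀ x → g x ≡ suc zero
  val = λ { zero → e₀ ; (suc zero) → e₁ }

boolean-involution : ∀ {n} → n ≡ 2 → (g : Fin n → Fin n) → ¬ Const g → ∀ x → g (g x) ≡ x
boolean-involution refl g ¬cst x with boolean-nonconst refl g ¬cst
... | inj₁ e = trans (e (g x)) (e x)
... | inj₂ e = toℕ-injective
  (trans (e (g x)) (trans (cong (1 ∸_) (e x)) (ℕₚ.m∸[m∸n]≡n (ℕₚ.≤-pred (toℕ<n x)))))

-- Changing a tuple of maps at a single point

module _ {m : ℕ} {k : Fin m → ℕ} where

  perturb : FunTuple m k → (i : Fin m) → Fin (k i) → Fin (k i) → FunTuple m k
  perturb h i σ v j with i ≟ j
  ... | yes refl = updateAt (h i) σ (const v)
  ... | no _     = h j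

  perturb-here : ∀ h i σ v → perturb h i σ v i ≡ updateAt (h i) σ (const v)
  perturb-here h i σ v with i ≟ i
  ... | yes refl = refl
  ... | no i≢i   = contradiction refl i≢i

  perturb-there : ∀ h i σ v {j} → i ≢ j → perturb h i σ v j ≡ h j
  perturb-there h i σ v {j} i≢j with i ≟ j
  ... | yes i≡j = contradiction i≡j i≢j
  ... | no _    = refl

  perturb-off : ∀ h i σ v (Q : ∀ j → Fin (k j) → Set) → ¬ Q i σ → ∀ j a → Q j a → perturb h i σ v j a ≡ h j a
  perturb-off h i σ v Q ¬q j a q with i ≟ j
  ... | yes refl = updateAt-minimal a σ (h i) λ { refl → ¬q q }
  ... | no _     = refl

-- Preservation, certificates and their decidability

module _ {m : ℕ} {k : Fin m → ℕ} (P : Predicate m k) where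
  open FinPred P renaming (_∈P to inP; dec to inP?; ext to inP-ext)

  Preserves₁ : FunTuple m k → Set
  Preserves₁ h = ∀ x → inP x → inP (λ i → h i (x i))

  Preserves₂ : BinTuple m k → Set
  Preserves₂ f = ∀ x z → inP x → inP z → inP (λ i → f i (x i) (z i))

  unary : FunTuple m k → NFun P 1
  unary h i v = h i (lookup v zero)

  binary : BinTuple m k → NFun P 2
  binary f i v = f i (lookup v zero) (lookup v (suc zero))

  -- The constant coordinates of h, with their values, form a certificate.
  Certified : {D : Fin m → Set} → ((i : Fin m) → D i → Fin (k i)) → Set
  Certified h = ∀ y → (∀ i → Const (h i) → ∀ u → y i ≡ h i u) → inP y

  -- Every coordinate fixed by `h` is fixed by `h′` to the same value, so whatever agrees with `h′`
  -- agrees with `h`.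
  certified-mono : {D D′ : Fin m → Set} {h : ∀ i → D i → Fin (k i)} {h′ : ∀ i → D′ i → Fin (k i)} →
    (∀ i → Const (h i) → Const (h′ i) × (∀ u → ∃ λ u′ → h i u ≡ h′ i u′)) → Certified h → Certified h′
  certified-mono c cert y agree = cert y λ i cst u →
    let cst′ , val = c i cst
        u′ , eq    = val u
    in trans (agree i cst′ u′) (sym eq)

  certified-cong : {D : Fin m → Set} {h h′ : ∀ i → D i → Fin (k i)} →
    (∀ i u → h i u ≡ h′ i u) → Certified h → Certified h′
  certified-cong h≈h′ cert y agree = cert y λ i cst u → trans
    (agree i (λ u v → trans (sym (h≈h′ i u)) (trans (cst u v) (h≈h′ i v))) u) (sym (h≈h′ i u))

  preserves₁? : ∀ h → Dec (Preserves₁ h)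
  preserves₁? h with compact-Tuple k (λ x → inP x → inP (λ i → h i (x i))) (¬ Preserves₁ h)
    (λ a b a≈b s p → inP-ext _ _ (λ i → cong (h i) (a≈b i)) (s (inP-ext b a (sym ∘ a≈b) p)))
    (λ x → case x (inP? x) (inP? _))
    where
    case : ∀ x → Dec (inP x) → Dec (inP (λ i → h i (x i))) → (inP x → inP (λ i → h i (x i))) ⊎ ¬ Preserves₁ h
    case x (no x∉)  _        = inj₁ λ x∈ → contradiction x∈ x∉
    case x (yes x∈) (yes y∈) = inj₁ λ _ → y∈
    case x (yes x∈) (no y∉)  = inj₂ λ pres → y∉ (pres x x∈)
  ... | inj₁ pres  = yes pres
  ... | inj₂ ¬pres = no ¬pres

  preserves₂? : ∀ f → Dec (Preserves₂ f)
  preserves₂? f with compact-Tuple k (λ x → inP x → ∀ z → inP z → inP (λ i → f i (x i) (z i))) (¬ Preserves₂ f)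
    (λ a b a≈b s p z z∈ → inP-ext _ _ (λ i → cong (λ t → f i t (z i)) (a≈b i)) (s (inP-ext b a (sym ∘ a≈b) p) z z∈))
    (λ x → row x (inP? x))
    where
    entry : ∀ x z → inP x → Dec (inP z) → Dec (inP (λ i → f i (x i) (z i))) →
      (inP z → inP (λ i → f i (x i) (z i))) ⊎ ¬ Preserves₂ f
    entry x z x∈ (no z∉)  _        = inj₁ λ z∈ → contradiction z∈ z∉
    entry x z x∈ (yes z∈) (yes y∈) = inj₁ λ _ → y∈
    entry x z x∈ (yes z∈) (no y∉)  = inj₂ λ pres → y∉ (pres x z x∈ z∈)
    row : ∀ x → Dec (inP x) → (inP x → ∀ z → inP z → inP (λ i → f i (x i) (z i))) ⊎ ¬ Preserves₂ f
    row x (no x∉)  = inj₁ λ x∈ → contradiction x∈ x∉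
    row x (yes x∈) = Sum.map₁ (λ s _ → s)
      (compact-Tuple k (λ z → inP z → inP (λ i → f i (x i) (z i))) (¬ Preserves₂ f)
        (λ a b a≈b s p → inP-ext _ _ (λ i → cong (f i (x i)) (a≈b i)) (s (inP-ext b a (sym ∘ a≈b) p)))
        (λ z → entry x z x∈ (inP? z) (inP? _)))
  ... | inj₁ pres  = yes λ x z x∈ z∈ → pres x x∈ z z∈
  ... | inj₂ ¬pres = no ¬pres

  -- Closure under setting a coordinate is preservation by the unary tuple that is constant there
  -- and the identity elsewhere.
  closed? : ∀ {Φ} → Dec (ClosedUnderSetting P Φ)
  closed? = any? λ i → any? λ σ → map′
    (λ pres y y∈ → inP-ext _ _ (setting-update i σ y) (pres y y∈))
    (λ clo y y∈ → inP-ext _ _ (λ j → sym (setting-update i σ y j)) (clo y y∈))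
    (preserves₁? (setting i σ))
    where
    setting : ∀ i → Fin (k i) → FunTuple m k
    setting i σ j a with i ≟ j
    ... | yes refl = σ
    ... | no _     = a
    setting-update : ∀ i σ y → (λ j → setting i σ j (y j)) ≈T update y i σ
    setting-update i σ y j with i ≟ j
    ... | yes refl = refl
    ... | no _     = refl

  certified? : ∀ h → Dec (Certified {Fin ∘ k} h)
  certified? h = decide (compact-Tuple k _ (¬ Certified h)
    (λ a b a≈b s agree → inP-ext a b a≈b (s λ i cst u → trans (a≈b i) (agree i cst u))) λ y → case y (agree? y) (inP? y))
    where
    Agree : Tuple m k → Set
    Agree y = ∀ i → Const (h i) → ∀ u → y i ≡ h i u
    agree? : ∀ y → Dec (Agree y)
    agree? y = all? λ i → const? (h i) →-dec all? λ u → y i ≟ h i u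
    case : ∀ y → Dec (Agree y) → Dec (inP y) → (Agree y → inP y) ⊎ ¬ Certified h
    case y _          (yes y∈) = inj₁ λ _ → y∈
    case y (no ¬agree) _       = inj₁ λ agree → contradiction agree ¬agree
    case y (yes agree) (no y∉) = inj₂ λ cert → y∉ (cert y agree)
    decide : (∀ y → Agree y → inP y) ⊎ ¬ Certified h → Dec (Certified h)
    decide (inj₁ cert)  = yes cert
    decide (inj₂ ¬cert) = no ¬cert

  poly⇒preserves₁ : ∀ h → IsPolymorphism P 1 (unary h) → Preserves₁ h
  poly⇒preserves₁ h poly x x∈ = poly (λ i → [ x i ]) λ { zero → x∈ }

  preserves₁⇒poly : ∀ h → Preserves₁ h → IsPolymorphism P 1 (unary h)
  preserves₁⇒poly h pres X X∈ = pres _ (X∈ zero)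

  poly⇒preserves₂ : ∀ f → IsPolymorphism P 2 (binary f) → Preserves₂ f
  poly⇒preserves₂ f poly x z x∈ z∈ = poly (λ i → x i ∷ z i ∷ []) λ { zero → x∈ ; (suc zero) → z∈ }

  preserves₂⇒poly : ∀ f → Preserves₂ f → IsPolymorphism P 2 (binary f)
  preserves₂⇒poly f pres X X∈ = pres _ _ (X∈ zero) (X∈ (suc zero))

  preserves₁-∘ : ∀ g h → Preserves₁ g → Preserves₁ h → Preserves₁ (λ i → g i ∘ h i)
  preserves₁-∘ g h pg ph x x∈ = pg _ (ph x x∈)

  preserves₁-fold : ∀ h → Preserves₁ h → ∀ n → Preserves₁ (λ i a → fold a (h i) n)
  preserves₁-fold h ph zero    x x∈ = x∈
  preserves₁-fold h ph (suc n) x x∈ = ph _ (preserves₁-fold h ph n x x∈)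

  preserves₂-fold : ∀ f → Preserves₂ f → ∀ n → Preserves₂ (λ i a b → fold b (f i a) n)
  preserves₂-fold f pf zero    x z x∈ z∈ = z∈
  preserves₂-fold f pf (suc n) x z x∈ z∈ = pf x _ x∈ (preserves₂-fold f pf n x z x∈ z∈)

  -- Some positive power of `h` is the identity, so the inverse is itself a power of `h` and
  -- preserves `P`.
  preserves₁-inverse : ∀ {h} → Preserves₁ h → (∀ i → Inj (h i)) →
    ∃ λ q → Preserves₁ q × (∀ i a → q i (h i a) ≡ a) × (∀ i a → h i (q i a) ≡ a)
  preserves₁-inverse {h} ph inj with common-period k
  ... | N , per = (λ i a → fold a (h i) N) , preserves₁-fold h ph N ,
    (λ i a → inj i (per i (inj i) (h i a))) , λ i a → per i (inj i) a

  poly-ext : ∀ {n} (f g : NFun P n) → (∀ i v → f i v ≡ g i v) → IsPolymorphism P n f → IsPolymorphism P n g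
  poly-ext f g f≈g poly X X∈ = inP-ext _ _ (λ i → f≈g i (X i)) (poly X X∈)

  cert⇒certified : ∀ {Φ n} {f : NFun P n} → CertificateType P Φ n f → Certified f
  cert⇒certified {n = n} (ρ , ρ-cert , f≡ρ) y agree = ρ-cert y λ i σ e →
    trans (agree i (λ u v → trans (f≡ρ i σ e u) (sym (f≡ρ i σ e v))) (replicate n σ)) (f≡ρ i σ e _)

  -- The domain of `ρ` consists of the constant coordinates; `pt` supplies a vector at which to read
  -- off the constant.
  certified⇒cert : ∀ {Φ n} {f : NFun P n} → (∀ i → Fin (k i)) → Certified f → CertificateType P Φ n f
  certified⇒cert {n = n} {f} pt cert = ρ , (λ y agree → cert y λ i cst u → agree i (f i u) (ρ-const i cst u)) , ρ-val
    where
    ρ : ∀ i → Maybe (Fin (k i))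
    ρ i with const-Vec? (f i)
    ... | yes _ = just (f i (replicate n (pt i)))
    ... | no _  = nothing
    ρ-const : ∀ i → Const (f i) → ∀ u → ρ i ≡ just (f i u)
    ρ-const i cst u with const-Vec? (f i)
    ... | yes _   = cong just (cst _ u)
    ... | no ¬cst = contradiction cst ¬cst
    ρ-val : ∀ i σ → ρ i ≡ just σ → ∀ x → f i x ≡ σ
    ρ-val i σ e x with const-Vec? (f i)
    ... | yes cst = trans (cst x _) (just-injective e)
    ρ-val i σ () x | no _

  module _ (Φ : Collection m k) where

    trivial-ext : ∀ {n} (f g : NFun P n) → (∀ i v → f i v ≡ g i v) →
      DictatorialType P Φ n f ⊎ CertificateType P Φ n f → DictatorialType P Φ n g ⊎ CertificateType P Φ n g
    trivial-ext f g f≈g (inj₁ (j , φ , φ∈ , eq)) = inj₁ (j , φ , φ∈ , λ i x → trans (sym (f≈g i x)) (eq i x))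
    trivial-ext f g f≈g (inj₂ (ρ , cert , eq))   = inj₂ (ρ , cert , λ i σ e x → trans (sym (f≈g i x)) (eq i σ e x))

    trivial₁⇒ : ∀ h → DictatorialType P Φ 1 (unary h) ⊎ CertificateType P Φ 1 (unary h) →
      FinPred._∈P Φ h ⊎ Certified h
    trivial₁⇒ h (inj₁ (zero , φ , φ∈ , eq)) = inj₁ (FinPred.ext Φ φ h (λ i σ → sym (eq i [ σ ])) φ∈)
    trivial₁⇒ h (inj₂ cert) = inj₂ (certified-mono {h = unary h} {h}
      (λ i cst → (λ u v → cst [ u ] [ v ]) , λ { (u ∷ []) → u , refl }) (cert⇒certified {Φ} cert))

    trivial₁⇐ : ∀ h → (∀ i → Fin (k i)) → FinPred._∈P Φ h ⊎ Certified h →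
      DictatorialType P Φ 1 (unary h) ⊎ CertificateType P Φ 1 (unary h)
    trivial₁⇐ h pt (inj₁ h∈)   = inj₁ (zero , h , h∈ , λ _ _ → refl)
    trivial₁⇐ h pt (inj₂ cert) = inj₂ (certified⇒cert {Φ} pt (certified-mono {h = h} {unary h}
      (λ i cst → (λ u v → cst _ _) , λ u → [ u ] , refl) cert))

-- Rigidity of predicates not closed under setting a coordinate

module NotClosed {m : ℕ} {k : Fin m → ℕ} (2≤k : ∀ i → 2 ≤ k i)
  (P : Predicate m k) (nd : NonDegenerate P) (Φ : Collection m k)
  (bij : ∀ φ → FinPred._∈P Φ φ → ∀ i → Bijective _≡_ _≡_ (φ i))
  (i₀ : Fin m) (triv : Trivial P Φ 1) (¬closed : ¬ ClosedUnderSetting P Φ) where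

  open FinPred P renaming (_∈P to inP; dec to inP?; ext to inP-ext)
  open FinPred Φ renaming (_∈P to inΦ; ext to inΦ-ext)

  inj : ∀ {φ} → inΦ φ → ∀ i → Inj (φ i)
  inj φ∈ i = proj₁ (bij _ φ∈ i)

  dichotomy : ∀ h → Preserves₁ P h → inΦ h ⊎ Certified P h
  dichotomy h ph = trivial₁⇒ P Φ h (triv (unary P h) (preserves₁⇒poly P h ph))

  not-full : ¬ (∀ y → inP y)
  not-full full = let _ , z , _ , z∉ , _ = proj₂ nd i₀ in z∉ (full z)

  point : ∀ i → Fin (k i)
  point i = first (2≤k i)

  -- h⁻¹ ∘ h′ is the identity off coordinate i, hence a certificate for it
  -- would fix coordinate i alone.
  rigid-at : ∀ h → Preserves₁ P h → (∀ i → Inj (h i)) → ∀ h′ → Preserves₁ P h′ →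
    ∀ i → (∀ j → i ≢ j → h′ j ≡ h j) → Inj (h′ i)
  rigid-at h ph h-inj h′ ph′ i off with preserves₁-inverse P ph h-inj
  ... | q , pq , q∘h , _ with dichotomy (λ j → q j ∘ h′ j) (preserves₁-∘ P q h′ pq ph′)
  ... | inj₁ φ∈  = λ eq → inj φ∈ i (cong (q i) eq)
  ... | inj₂ cert = ⊥-elim (¬closed (i , q i (h′ i (point i)) , λ y _ → cert _ (agree y)))
    where
    agree : ∀ y j → Const (q j ∘ h′ j) → ∀ u → update y i (q i (h′ i (point i))) j ≡ q j (h′ j u)
    agree y j cst u with i ≟ j
    ... | yes refl = cst _ u
    ... | no i≢j   = contradiction
      (λ a b → trans (sym (id-at a)) (trans (cst a b) (id-at b))) (inj⇒¬const (2≤k j) id (point j))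
      where
      id-at : ∀ a → q j (h′ j a) ≡ a
      id-at a = trans (cong (λ g → q j (g a)) (off j i≢j)) (q∘h j a)

  -- If a pair `(i , σ)` lay outside `Q`, moving its value to that of another point `τ` would give a
  -- non-injective polymorphism, against `rigid-at`.
  rigid : ∀ h → Preserves₁ P h → (∀ i → Inj (h i)) →
    (Q : ∀ i → Fin (k i) → Set) → (∀ i → Decidable (Q i)) →
    (∀ h′ → (∀ i a → Q i a → h′ i a ≡ h i a) → Preserves₁ P h′) → ∀ i a → Q i a
  rigid h ph h-inj Q Q? free i σ with Q? i σ
  ... | yes q = q
  ... | no ¬q = contradiction
    (rigid-at h ph h-inj h′ (free h′ (perturb-off h i σ v Q ¬q)) i (λ j → perturb-there h i σ v) collision)
    (other-≢ (2≤k i) σ ∘ sym)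
    where
    τ = other (2≤k i) σ
    v = h i τ
    h′ = perturb h i σ v
    collision : h′ i σ ≡ h′ i τ
    collision = trans (cong (λ g → g σ) (perturb-here h i σ v))
      (trans (updateAt-updates σ (h i))
        (sym (trans (cong (λ g → g τ) (perturb-here h i σ v)) (updateAt-minimal τ σ (h i) (other-≢ (2≤k i) σ)))))

  -- A certificate fixing no coordinate would put every tuple in `P`.
  certified-const : ∀ {h : FunTuple m k} → Certified P h → ¬ (∀ i → ¬ Const (h i))
  certified-const cert ¬cst = not-full λ y → cert y λ i cst → contradiction cst (¬cst i)

  -- Binary polymorphisms all of whose rows are certified

  FirstDictator : BinTuple m k → Set
  FirstDictator f = Σ (FunTuple m k) λ φ → inΦ φ × (∀ i a b → f i a b ≡ φ i a)

  rows-certified : ∀ f → (∀ x → inP x → Certified P (λ i → f i (x i))) →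
    FirstDictator f ⊎ Certified P (binary P f)
  rows-certified f cert = Sum.map dictator certified (dichotomy h (free h (λ i → proj₁ (proj₂ (spr i)))))
    where
    -- The row at `a` is constant; its value can then be read off the diagonal.
    R : ∀ i → Fin (k i) → Set
    R i a = ∀ b → f i a b ≡ f i a a
    R? : ∀ i → Decidable (R i)
    R? i a = all? λ b → f i a b ≟ f i a a
    spr = λ i → spread (2≤k i) (λ a → f i a a) (R? i)
    h : FunTuple m k
    h = λ i → proj₁ (spr i)
    h-on-R : ∀ i a → R i a → h i a ≡ f i a a
    h-on-R i = proj₁ (proj₂ (spr i))
    -- The certificate of row `x` involves only coordinates with constant row, where `h′` takes the
    -- row's value; elsewhere `h′` is arbitrary.
    free : ∀ h′ → (∀ i a → R i a → h′ i a ≡ f i a a) → Preserves₁ P h′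
    free h′ agree x x∈ = cert x x∈ _ λ i cst u → trans (agree i (x i) (λ b → cst b _)) (cst _ u)
    dictator : inΦ h → FirstDictator f
    dictator h∈ = h , h∈ , λ i a b → trans (all-R i a b) (sym (h-on-R i a (all-R i a)))
      where
      all-R : ∀ i a → R i a
      all-R = rigid h (free h h-on-R) (inj h∈) R R? λ h′ agree →
        free h′ λ i a r → trans (agree i a r) (h-on-R i a r)
    -- By the choice of `spread`, a constant `h i` forces all rows of `f i` to be constant, and then
    -- `f i` is constant with the same value.
    certified : Certified P h → Certified P (binary P f)
    certified = certified-mono P {h = h} {binary P f} λ i cst →
      let all-R = proj₂ (proj₂ (spr i)) cst
          val : ∀ a b → f i a b ≡ h i a
          val a b = trans (all-R a b) (sym (h-on-R i a (all-R a)))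
      in (λ { (a ∷ b ∷ []) (c ∷ e ∷ []) → trans (val a b) (trans (cst a c) (sym (val c e))) })
         , λ a → (a ∷ a ∷ []) , sym (val a a)

  -- From a polymorphism `sel (d i)` to a non-dictatorial AND/OR polymorphism

  module Semilattice (d : Tuple m k) (d∈ : inP d) (closed-sel : Preserves₂ P (λ i → sel (d i))) where

    -- Row `x` of `sel` is the identity where `x j ≡ d j` and the constant `x j` elsewhere. One
    -- constant coordinate excludes `Φ`, so the constants form a certificate.
    row-cert : ∀ x → inP x → ∀ i → x i ≢ d i → ∀ y → (∀ j → x j ≢ d j → y j ≡ x j) → inP y
    row-cert x x∈ i xi≢di y agree with dichotomy (λ j → sel (d j) (x j)) (λ z z∈ → closed-sel x z x∈ z∈)
    ... | inj₁ φ∈   = contradiction (λ u v → trans (sel-≢ u xi≢di) (sym (sel-≢ v xi≢di)))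
                        (inj⇒¬const (2≤k i) (inj φ∈ i) (point i))
    ... | inj₂ cert = cert y agree′
      where
      agree′ : ∀ j → Const (sel (d j) (x j)) → ∀ u → y j ≡ sel (d j) (x j) u
      agree′ j cst u = trans (agree j xj≢dj) (sym (sel-≢ u xj≢dj))
        where
        xj≢dj : x j ≢ d j
        xj≢dj eq = other-≢ (2≤k j) (d j) (trans (sym (sel-≡ _ eq)) (trans (cst _ _) (sel-≡ _ eq)))

    -- The column at `z` sends both `d i` and `z i` to `z i`, so it is not in `Φ`. It fixes every
    -- symbol other than `d j`, so it can be constant only on binary coordinates.
    column-cert : ∀ z → inP z → ∀ i → z i ≢ d i → ∀ y → (∀ j → k j ≡ 2 → y j ≡ z j) → inP y
    column-cert z z∈ i zi≢di y agree with dichotomy (λ j a → sel (d j) a (z j)) (λ x x∈ → closed-sel x z x∈ z∈)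
    ... | inj₁ φ∈   = contradiction (inj φ∈ i (trans (sel-idem (d i) (z i)) (sym (sel-≡ {d = d i} (z i) refl)))) zi≢di
    ... | inj₂ cert = cert y λ j cst u → trans
      (agree j (two-elements (2≤k j) (d j) (z j) λ a → split j cst a (a ≟ d j)))
      (trans (sym (sel-idem (d j) (z j))) (cst (z j) u))
      where
      split : ∀ j → Const (λ a → sel (d j) a (z j)) → ∀ a → Dec (a ≡ d j) → a ≡ d j ⊎ a ≡ z j
      split j cst a (yes a≡d) = inj₁ a≡d
      split j cst a (no a≢d)  = inj₂ (trans (sym (sel-≢ (z j) a≢d)) (trans (cst a (z j)) (sel-idem (d j) (z j))))

    andor : BinTuple m k
    andor i a b with k i ℕ.≟ 2
    ... | yes _ = sel (d i) a b
    ... | no _  = a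

    andor-2 : ∀ i → k i ≡ 2 → ∀ a b → andor i a b ≡ sel (d i) a b
    andor-2 i eq a b with k i ℕ.≟ 2
    ... | yes _ = refl
    ... | no ¬eq = contradiction eq ¬eq

    andor-≢d : ∀ i a b → a ≢ d i → andor i a b ≡ a
    andor-≢d i a b a≢d with k i ℕ.≟ 2
    ... | yes _ = sel-≢ b a≢d
    ... | no _  = refl

    andor-d : ∀ i → andor i (d i) (d i) ≡ d i
    andor-d i with k i ℕ.≟ 2
    ... | yes _ = sel-idem (d i) (d i)
    ... | no _  = refl

    andor-component : ∀ i → AndOrComponent P Φ i (binary P andor i)
    andor-component i with k i ℕ.≟ 2
    ... | yes eq = inj₂ (eq , sel-AND/OR eq (d i))
    ... | no ¬eq = inj₁ (ℕₚ.≤∧≢⇒< (2≤k i) (¬eq ∘ sym) , λ { (a ∷ b ∷ []) → refl })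

    differs? : ∀ (x : Tuple m k) → Dec (∃ λ i → x i ≢ d i)
    differs? x = any? λ i → ¬? (x i ≟ d i)

    same : ∀ {x : Tuple m k} → ¬ (∃ λ i → x i ≢ d i) → ∀ i → x i ≡ d i
    same {x} ¬diff i with x i ≟ d i
    ... | yes eq = eq
    ... | no neq = contradiction (i , neq) ¬diff

    -- If `x` differs from `d`, the result keeps the certificate of row `x`; if only `z` does, it
    -- agrees with `z` on binary coordinates; otherwise it is `d`.
    andor-preserves : Preserves₂ P andor
    andor-preserves x z x∈ z∈ with differs? x | differs? z
    ... | yes (i , xi≢di) | _ = row-cert x x∈ i xi≢di _ λ j xj≢dj → andor-≢d j (x j) (z j) xj≢dj
    ... | no x≡d | yes (i , zi≢di) = column-cert z z∈ i zi≢di _ λ j kj≡2 →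
      trans (andor-2 j kj≡2 (x j) (z j)) (sel-≡ (z j) (same x≡d j))
    ... | no x≡d | no z≡d = inP-ext d _
      (λ j → trans (sym (andor-d j)) (sym (cong₂ (andor j) (same x≡d j) (same z≡d j)))) d∈

    -- Without binary coordinates `column-cert` would demand nothing of `y`, making `P` full.
    -- Non-degeneracy provides a suitable `z` differing from `d`.
    some-binary : ∃ λ i → k i ≡ 2
    some-binary with any? (λ i → k i ℕ.≟ 2)
    ... | yes i = i
    ... | no ¬2 with proj₁ nd i₀ (other (2≤k i₀) (d i₀))
    ... | z , z∈ , zi≡ = ⊥-elim (not-full λ y →
      column-cert z z∈ i₀ (λ eq → other-≢ (2≤k i₀) (d i₀) (trans (sym zi≡) eq)) y
        λ j kj≡2 → contradiction (j , kj≡2) ¬2)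

    -- On a binary coordinate the first argument `d i` leaves the second one visible, while the
    -- other symbol `e` hides it.
    andor-nondictatorial : ¬ DictatorialType P Φ 2 (binary P andor)
    andor-nondictatorial (j , φ , φ∈ , eq) with some-binary
    ... | i , ki≡2 = case j eq
      where
      e = other (2≤k i) (d i)
      case : ∀ j → (∀ i x → binary P andor i x ≡ φ i (lookup x j)) → ⊥
      case zero eq = other-≢ (2≤k i) (d i)
        (trans (sym (trans (andor-2 i ki≡2 (d i) e) (sel-≡ {d = d i} e refl)))
          (trans (eq i (d i ∷ e ∷ [])) (trans (sym (eq i (d i ∷ d i ∷ []))) (andor-d i))))
      case (suc zero) eq = inj⇒¬const (2≤k i) (inj φ∈ i) (d i) λ u v →
        trans (value u) (sym (value v))
        where
        value : ∀ u → φ i u ≡ e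
        value u = trans (sym (eq i (e ∷ u ∷ []))) (andor-≢d i e u (other-≢ (2≤k i) (d i)))

    nondictatorial-andor : HasNonDictatorialAndOr P Φ
    nondictatorial-andor = binary P andor , preserves₂⇒poly P andor andor-preserves ,
      andor-component , andor-nondictatorial

  -- Mixed rows, once the rows in `Φ` have become identities

  module Mixed (g : BinTuple m k) (pg : Preserves₂ P g)
    (rows : ∀ x → inP x → (∀ i b → g i (x i) b ≡ b) ⊎ Certified P (λ i → g i (x i)))
    (d : Tuple m k) (d∈ : inP d) (d-row : ∀ i b → g i (d i) b ≡ b)
    (c : Tuple m k) (c∈ : inP c) (c-row : Certified P (λ i → g i (c i))) where

    -- As row `d` is the identity, a constant column at `b` has value `b`. Rigidity of the identity
    -- makes `g` the second projection, so row `c` has no constant coordinate to certify.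
    not-all-columns-certified : ¬ (∀ z → inP z → Certified P (λ i a → g i a (z i)))
    not-all-columns-certified cert = certified-const c-row λ i →
      inj⇒¬const (2≤k i) (λ {a} {b} eq → trans (sym (all-E i a (c i))) (trans eq (all-E i b (c i)))) (point i)
      where
      E : ∀ i → Fin (k i) → Set
      E i b = ∀ a → g i a b ≡ b
      all-E : ∀ i b → E i b
      all-E = rigid (λ _ → id) (λ _ x∈ → x∈) (λ _ → id) E (λ i b → all? λ a → g i a b ≟ b)
        λ h′ agree x x∈ → cert x x∈ _ λ i cst u →
          let e : E i (x i)
              e a = trans (cst a (d i)) (d-row i (x i))
          in trans (agree i (x i) e) (sym (e u))

    module _ (z : Tuple m k) (z∈ : inP z) (p∈ : inΦ (λ i a → g i a (z i))) where

      p : FunTuple m k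
      p i a = g i a (z i)

      p-preserves : Preserves₁ P p
      p-preserves x x∈ = pg x z x∈ z∈

      Q : ∀ i → Fin (k i) → Set
      Q i a = (∀ b → g i a b ≡ b) ⊎ (∀ b → g i a b ≡ p i a)

      -- Rigidity of `p`: on an identity row the changed map must agree with `p` everywhere, and on
      -- a certified row it must agree wherever the row is constant, which secures membership.
      all-Q : ∀ i a → Q i a
      all-Q = rigid p p-preserves (inj p∈) Q
        (λ i a → all? (λ b → g i a b ≟ b) ⊎-dec all? (λ b → g i a b ≟ p i a)) free
        where
        free : ∀ h′ → (∀ i a → Q i a → h′ i a ≡ p i a) → Preserves₁ P h′
        free h′ agree x x∈ with rows x x∈
        ... | inj₁ idr  = inP-ext _ _ (λ i → sym (agree i (x i) (inj₁ (idr i)))) (p-preserves x x∈)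
        ... | inj₂ cert = cert _ λ i cst u → trans (agree i (x i) (inj₂ λ b → cst b (z i))) (cst (z i) u)

      -- The polymorphism is `g (q x) w` with `q` inverse to `p`. Since `p` maps `d` to `z`, the
      -- symbol `z i` selects the identity row; any other `a` selects a constant row, of value
      -- `p (q a) = a`.
      sel-preserves : Preserves₂ P (λ i → sel (z i))
      sel-preserves with preserves₁-inverse P p-preserves (inj p∈)
      ... | q , pq , q∘p , p∘q = λ x w x∈ w∈ →
        inP-ext _ _ (λ i → value i (x i) (w i)) (pg _ w (pq x x∈) w∈)
        where
        value : ∀ i a b → g i (q i a) b ≡ sel (z i) a b
        value i a b with all-Q i (q i a) | a ≟ z i
        ... | inj₁ idr | yes _  = idr b
        ... | inj₁ idr | no a≢z = contradiction (trans (sym (p∘q i a)) (idr (z i))) a≢z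
        ... | inj₂ cst | no _   = trans (cst b) (p∘q i a)
        ... | inj₂ cst | yes a≡z = trans (cong (λ t → g i t b) q≡d) (d-row i b)
          where
          q≡d : q i a ≡ d i
          q≡d = inj p∈ i (trans (p∘q i a) (trans a≡z (sym (d-row i (z i)))))

    nondictatorial-andor : HasNonDictatorialAndOr P Φ
    nondictatorial-andor with compact-Tuple k
      (λ z → inP z → Certified P (λ i a → g i a (z i)))
      (∃ λ z → inP z × inΦ (λ i a → g i a (z i)))
      (λ a b a≈b s b∈ → certified-cong P (λ i u → cong (g i u) (a≈b i)) (s (inP-ext b a (sym ∘ a≈b) b∈)))
      (λ z → column z (inP? z))
      where
      column : ∀ z → Dec (inP z) → (inP z → Certified P (λ i a → g i a (z i))) ⊎ (∃ λ z → inP z × inΦ (λ i a → g i a (z i)))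
      column z (no z∉)  = inj₁ λ z∈ → contradiction z∈ z∉
      column z (yes z∈) with dichotomy (λ i a → g i a (z i)) (λ x x∈ → pg x z x∈ z∈)
      ... | inj₁ φ∈   = inj₂ (z , z∈ , φ∈)
      ... | inj₂ cert = inj₁ λ _ → cert
    ... | inj₁ cert          = ⊥-elim (not-all-columns-certified cert)
    ... | inj₂ (z , z∈ , φ∈) = Semilattice.nondictatorial-andor z z∈ (sel-preserves z z∈ φ∈)

  -- Classifying a binary polymorphism by its rows and columns

  rows-mixed : ∀ f → Preserves₂ P f → ∀ d → inP d → inΦ (λ i → f i (d i)) →
    ∀ c → inP c → Certified P (λ i → f i (c i)) → HasNonDictatorialAndOr P Φ
  rows-mixed f pf d d∈ φ∈ c c∈ cert with common-period k
  ... | N , period = Mixed.nondictatorial-andor g (preserves₂-fold P f pf (suc N)) rows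
                       d d∈ (id-row d φ∈) c c∈ (cert-row c cert)
    where
    g : BinTuple m k
    g i a b = fold b (f i a) (suc N)
    id-row : ∀ x → inΦ (λ i → f i (x i)) → ∀ i b → g i (x i) b ≡ b
    id-row x φ∈ i = period i (inj φ∈ i)
    cert-row : ∀ x → Certified P (λ i → f i (x i)) → Certified P (λ i → g i (x i))
    -- The exponent is positive, so the outermost application of a constant row returns its
    -- constant.
    cert-row x = certified-mono P {h = λ i → f i (x i)} {λ i → g i (x i)} λ i cst →
      (λ u v → cst _ _) , λ u → u , cst _ _
    rows : ∀ x → inP x → (∀ i b → g i (x i) b ≡ b) ⊎ Certified P (λ i → g i (x i))
    rows x x∈ = Sum.map (id-row x) (cert-row x) (dichotomy _ (λ z → pf x z x∈))

  -- Two searches with exchanged roles: one for a row in `Φ`, one for a certified row. Finding both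
  -- is the mixed case.
  analyse-rows : ∀ f → Preserves₂ P f →
    (FirstDictator f ⊎ Certified P (binary P f)) ⊎ HasNonDictatorialAndOr P Φ ⊎ (∀ x → inP x → inΦ (λ i → f i (x i)))
  analyse-rows f pf = decide
    (search (λ h → Certified P h) inΦ (λ _ _ → certified-cong P) Sum.swap)
    (search inΦ (λ h → Certified P h) (λ h h′ h≈h′ → inΦ-ext h h′ h≈h′) id)
    where
    search : (S T : FunTuple m k → Set) → (∀ h h′ → h ≈F h′ → S h → S h′) →
      (∀ {h} → inΦ h ⊎ Certified P h → S h ⊎ T h) →
      (∀ x → inP x → S (λ i → f i (x i))) ⊎ (∃ λ x → inP x × T (λ i → f i (x i)))
    search S T resp choose = compact-Tuple k _ _
      (λ a b a≈b s b∈ → resp _ _ (λ i u → cong (λ t → f i t u) (a≈b i)) (s (inP-ext b a (sym ∘ a≈b) b∈)))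
      λ x → row x (inP? x)
      where
      row : ∀ x → Dec (inP x) → (inP x → S (λ i → f i (x i))) ⊎ (∃ λ x → inP x × T (λ i → f i (x i)))
      row x (no x∉)  = inj₁ λ x∈ → contradiction x∈ x∉
      row x (yes x∈) with choose (dichotomy (λ i → f i (x i)) (λ z → pf x z x∈))
      ... | inj₁ s = inj₁ λ _ → s
      ... | inj₂ t = inj₂ (x , x∈ , t)
    decide : _ ⊎ _ → _ ⊎ _ → _
    decide (inj₁ cert) _ = inj₁ (rows-certified f cert)
    decide (inj₂ _) (inj₁ φ∈) = inj₂ (inj₂ φ∈)
    decide (inj₂ (d , d∈ , φ∈)) (inj₂ (c , c∈ , cert)) = inj₂ (inj₁ (rows-mixed f pf d d∈ φ∈ c c∈ cert))

  analyse : ∀ f → Preserves₂ P f →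
    (DictatorialType P Φ 2 (binary P f) ⊎ CertificateType P Φ 2 (binary P f))
      ⊎ HasNonDictatorialAndOr P Φ ⊎ HasConformingLatinSquare P Φ
  analyse f pf with analyse-rows f pf | analyse-rows (λ i → flip (f i)) (λ x z x∈ z∈ → pf z x z∈ x∈)
  ... | inj₁ (inj₁ (φ , φ∈ , eq)) | _ = inj₁ (inj₁ (zero , φ , φ∈ , λ i v → eq i _ _))
  ... | inj₁ (inj₂ cert) | _ = inj₁ (inj₂ (certified⇒cert P {Φ} point cert))
  ... | inj₂ (inj₁ andor) | _ = inj₂ (inj₁ andor)
  ... | inj₂ (inj₂ _) | inj₁ (inj₁ (φ , φ∈ , eq)) = inj₁ (inj₁ (suc zero , φ , φ∈ , λ i v → eq i _ _))
  ... | inj₂ (inj₂ _) | inj₁ (inj₂ cert) = inj₁ (inj₂ (certified⇒cert P {Φ} point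
    (certified-mono P {h = binary P (λ i → flip (f i))} {binary P f}
      (λ i cst → (λ { (a ∷ b ∷ []) (c ∷ e ∷ []) → cst (b ∷ a ∷ []) (e ∷ c ∷ []) }) ,
                 λ { (a ∷ b ∷ []) → (b ∷ a ∷ []) , refl }) cert)))
  ... | inj₂ (inj₂ _) | inj₂ (inj₁ andor) = inj₂ (inj₁ andor)
  ... | inj₂ (inj₂ rows) | inj₂ (inj₂ columns) = inj₂ (inj₂ (binary P f , preserves₂⇒poly P f pf , latin ,
    λ y y∈ → rows y y∈ , columns y y∈))
    where
    latin : ∀ i → IsLatinSquare P Φ i (binary P f i)
    latin i = (λ a → bijective (λ a → Bijective _≡_ _≡_ (f i a)) (λ y y∈ → bij _ (rows y y∈) i) a)
            , (λ a → bijective (λ a → Bijective _≡_ _≡_ (flip (f i) a)) (λ y y∈ → bij _ (columns y y∈) i) a)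
      where
      -- By non-degeneracy every symbol occurs at coordinate `i` of some member of `P`, so a
      -- property of the rows at members covers all rows.
      bijective : (B : Fin (k i) → Set) → (∀ y → inP y → B (y i)) → ∀ a → B a
      bijective B b a with proj₁ nd i a
      ... | y , y∈ , eq = subst B eq (b y y∈)

  -- Searching the finitely many binary tuples of operations turns the alternative for each one into
  -- a single alternative for `P`.
  trivial₂ : Trivial P Φ 2 ⊎ HasNonDictatorialAndOr P Φ ⊎ HasConformingLatinSquare P Φ
  trivial₂ = Sum.map₁ conclude (compact-BinTuple k S _ resp each)
    where
    S : BinTuple m k → Set
    S f = Preserves₂ P f → DictatorialType P Φ 2 (binary P f) ⊎ CertificateType P Φ 2 (binary P f)
    resp : ∀ f g → f ≈B g → S f → S g
    resp f g f≈g s pg = trivial-ext P Φ (binary P f) (binary P g) (λ i v → f≈g i _ _)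
      (s λ x z x∈ z∈ → inP-ext _ _ (λ i → sym (f≈g i _ _)) (pg x z x∈ z∈))
    each : ∀ f → S f ⊎ (HasNonDictatorialAndOr P Φ ⊎ HasConformingLatinSquare P Φ)
    each f with preserves₂? P f
    ... | no ¬pf = inj₁ λ pf → contradiction pf ¬pf
    ... | yes pf = Sum.map₁ const (analyse f pf)
    conclude : (∀ f → S f) → Trivial P Φ 2
    conclude all-S F poly = trivial-ext P Φ (binary P f) F (λ i v → sym (eta i v))
      (all-S f (poly⇒preserves₂ P f (poly-ext P F (binary P f) eta poly)))
      where
      f : BinTuple m k
      f i a b = F i (a ∷ b ∷ [])
      eta : ∀ i v → F i v ≡ binary P f i v
      eta i (a ∷ b ∷ []) = refl

-- Witnesses of non-triviality over two-element alphabets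

module Boolean {m : ℕ} {k : Fin m → ℕ} (k≡2 : ∀ i → k i ≡ 2) (P : Predicate m k) (Φ : Collection m k)
  (bij : ∀ φ → FinPred._∈P Φ φ → ∀ i → Bijective _≡_ _≡_ (φ i)) where

  open FinPred Φ renaming (_∈P to inΦ; dec to inΦ?; ext to inΦ-ext)

  2≤k : ∀ i → 2 ≤ k i
  2≤k i = ℕₚ.≤-reflexive (sym (k≡2 i))

  point : ∀ i → Fin (k i)
  point i = first (2≤k i)

  Nontrivial : FunTuple m k → Set
  Nontrivial h = Preserves₁ P h × ¬ (inΦ h ⊎ Certified P h)

  -- Preservation, `Φ` and being certified are all decidable, so an exhaustive search yields an
  -- explicit counterexample.
  nontrivial : ¬ Trivial P Φ 1 → ∃ Nontrivial
  nontrivial ¬triv = Sum.[ (λ all-S → contradiction (triv all-S) ¬triv) , id ] (compact-FunTuple k S _ resp each)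
    where
    S : FunTuple m k → Set
    S h = Preserves₁ P h → inΦ h ⊎ Certified P h
    resp : ∀ f g → f ≈F g → S f → S g
    resp f g f≈g s pg = Sum.map (inΦ-ext f g f≈g) (certified-cong P f≈g)
      (s λ x x∈ → FinPred.ext P _ _ (λ i → sym (f≈g i (x i))) (pg x x∈))
    each : ∀ h → S h ⊎ ∃ Nontrivial
    each h with preserves₁? P h | inΦ? h ⊎-dec certified? P h
    ... | _      | yes t = inj₁ λ _ → t
    ... | no ¬ph | _     = inj₁ λ ph → contradiction ph ¬ph
    ... | yes ph | no ¬t = inj₂ (h , ph , ¬t)
    triv : (∀ h → S h) → Trivial P Φ 1
    triv all-S F poly = trivial-ext P Φ (unary P h) F (λ i v → sym (eta i v))
      (trivial₁⇐ P Φ h point (all-S h (poly⇒preserves₁ P h (poly-ext P F (unary P h) eta poly))))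
      where
      h : FunTuple m k
      h i a = F i [ a ]
      eta : ∀ i v → F i v ≡ unary P h i v
      eta i (a ∷ []) = refl

  witness : ∀ h → Nontrivial h → Witnesses1 P Φ (unary P h)
  witness h (ph , ¬t) = preserves₁⇒poly P h ph , ¬t ∘ trivial₁⇒ P Φ h

  -- A non-constant self-map of a two-element set is an involution, so its square is the identity.
  const-or-id : ∀ (h : FunTuple m k) → ConstOrId P Φ (unary P (λ i → h i ∘ h i))
  const-or-id h i with const? (h i)
  ... | no ¬cst = inj₂ (inj₂ (boolean-involution (k≡2 i) (h i) ¬cst))
  ... | yes cst with boolean-const (k≡2 i) (h i) cst
  ... | inj₁ e = inj₁ λ x → e (h i x)
  ... | inj₂ e = inj₂ (inj₁ λ x → e (h i x))

  -- Squaring keeps the constant coordinates and their values, and creates no new ones.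
  nontrivial-square : ∀ h → Nontrivial h → ∀ i → Const (h i) → Nontrivial (λ i → h i ∘ h i)
  nontrivial-square h (ph , ¬t) i cst = preserves₁-∘ P h h ph ph , Sum.[ not-in , not-certified ]
    where
    not-in : ¬ inΦ (λ i → h i ∘ h i)
    not-in h∈ = inj⇒¬const (2≤k i) (proj₁ (bij _ h∈ i)) (point i) λ u v → cst (h i u) (h i v)
    square-const : ∀ j → Const (h j ∘ h j) → Const (h j)
    square-const j c with const? (h j)
    ... | yes cst = cst
    ... | no ¬cst = contradiction
      (λ u v → trans (sym (inv u)) (trans (c u v) (inv v))) (inj⇒¬const (2≤k j) id (point j))
      where inv = boolean-involution (k≡2 j) (h j) ¬cst
    not-certified : ¬ Certified P (λ i → h i ∘ h i)
    not-certified cert = ¬t (inj₂ (certified-mono P {h = λ i → h i ∘ h i} {h}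
      (λ j c → square-const j c , λ u → h j u , refl) cert))

  boolean-witness : ¬ Trivial P Φ 1 →
    (Σ (NFun P 1) λ f → Witnesses1 P Φ f × ConstOrId P Φ f) ⊎ (Σ (NFun P 1) λ f → Witnesses1 P Φ f × IdOrNeg P Φ f)
  boolean-witness ¬triv with nontrivial ¬triv
  ... | h , nt with any? (λ i → const? (h i))
  ... | yes (i , cst) = inj₁ (_ , witness (λ i → h i ∘ h i) (nontrivial-square h nt i cst) , const-or-id h)
  ... | no ¬cst       = inj₂ (_ , witness h nt , λ i → boolean-nonconst (k≡2 i) (h i) (λ c → ¬cst (i , c)))

-- With no coordinates the identity already decides the type of every polymorphism.
trivial-nullary : (k : Fin 0 → ℕ) (P : Predicate 0 k) (Φ : Collection 0 k) → Trivial P Φ 1 → Trivial P Φ 2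
trivial-nullary k P Φ triv f poly with triv (λ i → head) (λ X X∈ → FinPred.ext P _ _ (λ ()) (X∈ zero))
... | inj₁ (_ , φ , φ∈ , _) = inj₁ (zero , φ , φ∈ , λ ())
... | inj₂ (ρ , cert , _)   = inj₂ (ρ , cert , λ ())

theorem4 : (m : ℕ) (k : Fin m → ℕ) → (∀ i → 2 ≤ k i) →
    (P : Predicate m k) → NonDegenerate P →
    (Φ : Collection m k) →
    (∀ φ → FinPred._∈P Φ φ → ∀ i → Bijective _≡_ _≡_ (φ i)) →
    ((Trivial P Φ 1 →
        Trivial P Φ 2 ⊎ ClosedUnderSetting P Φ ⊎ HasNonDictatorialAndOr P Φ
          ⊎ HasConformingLatinSquare P Φ)
     × ((∀ i → k i ≡ 2) → ¬ Trivial P Φ 1 →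
          (Σ (NFun P 1) λ f → Witnesses1 P Φ f × ConstOrId P Φ f)
          ⊎ (Σ (NFun P 1) λ f → Witnesses1 P Φ f × IdOrNeg P Φ f)))
theorem4 m k 2≤k P nd Φ bij = binary-part m k 2≤k P nd Φ bij , λ k≡2 → Boolean.boolean-witness k≡2 P Φ bij
  where
  binary-part : ∀ m (k : Fin m → ℕ) → (∀ i → 2 ≤ k i) → (P : Predicate m k) → NonDegenerate P →
    (Φ : Collection m k) → (∀ φ → FinPred._∈P Φ φ → ∀ i → Bijective _≡_ _≡_ (φ i)) → Trivial P Φ 1 →
    Trivial P Φ 2 ⊎ ClosedUnderSetting P Φ ⊎ HasNonDictatorialAndOr P Φ ⊎ HasConformingLatinSquare P Φ
  binary-part zero    k 2≤k P nd Φ bij triv = inj₁ (trivial-nullary k P Φ triv)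
  binary-part (suc m) k 2≤k P nd Φ bij triv with closed? P {Φ}
  ... | yes closed = inj₂ (inj₁ closed)
  -- Coordinate `zero` is the one at which non-degeneracy yields a tuple outside `P`.
  ... | no ¬closed = Sum.map₂ inj₂ (NotClosed.trivial₂ 2≤k P nd Φ bij zero triv ¬closed)
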